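{- There exists an uncountable semigroup $(S,+)$ which is very weakly cancellative, has no idempotent element, and in which every uncountable subset of $S$ is an IP set.
   Context: For an infinite semigroup $S$ of cardinality $\kappa$: a left solution set is a set $\{x\in S: a+x=b\}$ and a right solution set is a set $\{x\in S: x+a=b\}$ for some $a,b\in S$; $S$ is very weakly cancellative if the union of fewer than $\kappa$ left solution sets has cardinality less than $\kappa$ and the union of fewer than $\kappa$ right solution sets has cardinality less than $\kappa$. $e$ is idempotent if $e+e=e$. $A\subseteq S$ is an IP set if there is a sequence $\langle x_n\rangle_{n=1}^\infty$ in $S$ such that every finite sum $\sum_{n\in H}x_n$ (in increasing order of indices, $H$ a nonempty finite subset of $\mathbb{N}$) lies in $A$. -}

module Defs where

open import Algebra.Bundles using (Semigroup)
open import Data.List.NonEmpty using (List⁺; foldr₁; map; toList)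
open import Data.List.Relation.Unary.Linked using (Linked)
open import Data.Nat.Base using (ℕ; _<_)
open import Data.Product.Base using (_×_; proj₁; ∃-syntax)
open import Function.Bundles using (Func; Injection)
open import Level using (0ℓ)
open import Relation.Binary.Bundles using (Setoid)
import Relation.Binary.Construct.On as On
open import Relation.Binary.PropositionalEquality using (setoid)
open import Relation.Nullary.Negation using (¬_)
open import Relation.Unary using (Pred; _≐_)
open import Relation.Unary.Relation.Binary.Equality using (≐-setoid)

-- A set is a setoid: its elements are compared, and hence counted, up to _≈_.
-- |A| < |B| means that A injects into B but B does not inject into A.

infix 4 _≺_

_≺_ : Setoid 0ℓ 0ℓ → Setoid 0ℓ 0ℓ → Set
A ≺ B = Injection A B × ¬ Injection B A

-- Finite sets count as countable.

Countable : Setoid 0ℓ 0ℓ → Set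
Countable A = Injection A (setoid ℕ)

Uncountable : Setoid 0ℓ 0ℓ → Set
Uncountable A = ¬ Countable A

-- The elements of X satisfying P, with the equality of X (so the proofs of
-- P x do not contribute to the cardinality).

subset : (X : Setoid 0ℓ 0ℓ) → Pred (Setoid.Carrier X) 0ℓ → Setoid 0ℓ 0ℓ
subset X P = On.setoid X (proj₁ {B = P})

module _ (S : Semigroup 0ℓ 0ℓ) where

  open Semigroup S using (Carrier; _≈_) renaming (_∙_ to _+_; setoid to |S|)

  IsLeftSolutionSet : Pred Carrier 0ℓ → Set
  IsLeftSolutionSet P = ∃[ a ] ∃[ b ] P ≐ (λ x → (a + x) ≈ b)

  IsRightSolutionSet : Pred Carrier 0ℓ → Set
  IsRightSolutionSet P = ∃[ a ] ∃[ b ] P ≐ (λ x → (x + a) ≈ b)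

  -- The union of fewer than κ = |S| sets satisfying Q has fewer than κ
  -- elements.  A collection of fewer than κ sets is a family of subsets indexed
  -- by a set I with |I| < κ; equal indices give extensionally equal subsets.

  SmallUnions : (Pred Carrier 0ℓ → Set) → Set₁
  SmallUnions Q =
    (I : Setoid 0ℓ 0ℓ) → I ≺ |S| →
    (L : Func I (≐-setoid Carrier 0ℓ)) → (∀ i → Q (Func.to L i)) →
    subset |S| (λ x → ∃[ i ] Func.to L i x) ≺ |S|

  VeryWeaklyCancellative : Set₁
  VeryWeaklyCancellative =
    SmallUnions IsLeftSolutionSet × SmallUnions IsRightSolutionSet

  -- A nonempty finite set H of indices is given by its strictly increasing
  -- enumeration, which is also the order in which the sum is taken.

  IsIP : Pred Carrier 0ℓ → Set
  IsIP A = ∃[ x ] ((H : List⁺ ℕ) → Linked _<_ (toList H) →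
                   A (foldr₁ _+_ (map x H)))

module Submission where

open import Defs
open import Algebra.Bundles using (Semigroup)
open import Algebra.Definitions using (_IdempotentOn_)
import Algebra.Construct.LexProduct as LexProduct
import Algebra.Construct.NaturalChoice.Max as Max
open import Axiom.ExcludedMiddle using (ExcludedMiddle)
open import Data.List.Base using ([]; _∷_)
open import Data.List.NonEmpty using (_∷_; foldr₁; map)
open import Data.List.Relation.Unary.Linked using (Linked; _∷_)
open import Data.Nat.Base as ℕ using (ℕ; zero; suc)
open import Data.Nat.Binary.Base using (ℕᵇ; zero; 2[1+_]; 1+[2_]; toℕ; fromℕ)
open import Data.Nat.Binary.Properties using (fromℕ-toℕ)
open import Data.Nat.Induction using (<-wellFounded)
import Data.Nat.Properties as ℕ
open import Data.Product.Base using (_×_; _,_; proj₁; proj₂; Σ-syntax; ∃; ∃-syntax)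
open import Data.Product.Relation.Binary.Pointwise.NonDependent using (×-setoid)
open import Data.Sum.Base as Sum using (_⊎_; inj₁; inj₂)
open import Function.Base using (_∘_; const; id)
open import Function.Bundles using (Func; Injection)
import Function.Construct.Composition as Composition
open import Induction.WellFounded using (WellFounded; Acc; acc)
open import Level using (0ℓ)
open import Relation.Binary.Bundles using (Setoid; TotalOrder)
import Relation.Binary.Construct.On as On
open import Relation.Binary.Core using (Rel)
open import Relation.Binary.Definitions using (_Respects_)
open import Relation.Binary.PropositionalEquality as ≡ using (_≡_; refl)
import Relation.Binary.PropositionalEquality.Algebra as ≡
open import Relation.Nullary.Decidable.Core using (Dec; yes; no; decidable-stable)
open import Relation.Nullary.Negation using (¬_; contradiction)
open import Relation.Unary using (Pred)

-- The semigroup is ω₁ × ℕ with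
--   (α , m) + (β , n) = the argument with the larger ordinal, if α ≠ β,
--   (α , m) + (α , n) = (α , m + n + 1).
-- The second clause rules out idempotents.  A solution of a + x = b or x + a = b
-- has its ordinal at most that of b, so by regularity of ω₁ a countable union of
-- solution sets is bounded, hence countable.  An uncountable A is unbounded, so it
-- contains a sequence with strictly increasing ordinals; every finite sum along
-- it equals its last term.
--
-- Excluded middle decides arbitrary types, not only propositions, so it returns
-- witnesses and acts as a choice operator.  The chosen values need not respect a
-- setoid equality; where that matters a least witness is taken.

-- Brouwer trees, read as the countable ordinals: lsub f is the least strict
-- upper bound of the sequence f, so the trees form a copy of ω₁.

data Ord : Set where
  zero : Ord
  lsub : (ℕ → Ord) → Ord

infix 4 _≤_ _<_ _≃_

data _≤_ : Rel Ord 0ℓ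
data _<_ : Rel Ord 0ℓ

data _≤_ where
  zero≤ : ∀ {y} → zero ≤ y
  least : ∀ {f y} → (∀ n → f n < y) → lsub f ≤ y

data _<_ where
  below : ∀ {x f} n → x ≤ f n → x < lsub f

-- Different trees can denote the same ordinal, so ordinals are compared by `_≃_` and not by `_≡_`.
_≃_ : Rel Ord 0ℓ
x ≃ y = x ≤ y × y ≤ x

<⇒≤ : ∀ {x y} → x < y → x ≤ y
<⇒≤ (below n zero≤)     = zero≤
<⇒≤ (below n (least p)) = least λ k → below n (<⇒≤ (p k))

≤-refl : ∀ {x} → x ≤ x
≤-refl {zero}   = zero≤
≤-refl {lsub f} = least λ n → below n ≤-refl

≤-trans : ∀ {x y z} → x ≤ y → y ≤ z → x ≤ z
<-≤-trans : ∀ {x y z} → x < y → y ≤ z → x < z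
≤-<-trans : ∀ {x y z} → x ≤ y → y < z → x < z

≤-trans zero≤     q = zero≤
≤-trans (least p) q = least λ n → <-≤-trans (p n) q

<-≤-trans (below n p) (least q) = ≤-<-trans p (q n)

≤-<-trans p (below n q) = below n (≤-trans p q)

<-irrefl : ∀ {x} → ¬ x < x
<-irrefl (below n (least p)) = <-irrefl (p n)

<-wf : WellFounded _<_
<-wf x = acc (down x)
  where
  -- The recursion is on the tree: what lies below `lsub f` lies under some child `f n`, and so
  -- anything smaller still is strictly below that child.
  down : ∀ x {y} → y < x → Acc _<_ y
  down (lsub f) (below n y≤) = acc λ z<y → down (f n) (<-≤-trans z<y y≤)

f<lsub : ∀ {f} n → f n < lsub f
f<lsub n = below n ≤-refl

≃-setoid : Setoid 0ℓ 0ℓ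
≃-setoid = record
  { _≈_           = _≃_
  ; isEquivalence = record
    { refl  = ≤-refl , ≤-refl
    ; sym   = λ (p , q) → q , p
    ; trans = λ (p , q) (r , s) → ≤-trans p r , ≤-trans s q
    }
  }

private
  module ≃ = Setoid ≃-setoid

-- A binary word directs a walk through the tree: 2[1+_] drops the first child
-- and 1+[2_] descends into it.

subtree : Ord → ℕᵇ → Ord
subtree zero     w        = zero
subtree (lsub f) zero     = lsub f
subtree (lsub f) 2[1+ w ] = subtree (lsub (f ∘ suc)) w
subtree (lsub f) 1+[2 w ] = subtree (f 0) w

child : ℕ → ℕᵇ → ℕᵇ
child zero    w = 1+[2 w ]
child (suc n) w = 2[1+ child n w ]

subtree-child : ∀ f n w → subtree (lsub f) (child n w) ≡ subtree (f n) w
subtree-child f zero    w = refl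
subtree-child f (suc n) w = subtree-child (f ∘ suc) n w

-- scale x is ω · x, so rank embeds Ord × ℕ, ordered lexicographically, into Ord.

scale : Ord → Ord
rank : Ord → ℕ → Ord

scale zero     = zero
scale (lsub f) = lsub λ n → lsub (rank (f n))

rank x zero    = scale x
rank x (suc k) = lsub (const (rank x k))

scale≤rank : ∀ x k → scale x ≤ rank x k
scale≤rank x zero    = ≤-refl
scale≤rank x (suc k) = ≤-trans (scale≤rank x k) (<⇒≤ (f<lsub 0))

-- The hypothesis is on `scale`, so that `scale-mono` can use this lemma in its own recursion.
rank-mono : ∀ {x y} k → scale x ≤ scale y → rank x k ≤ rank y k
rank-mono zero    p = p
rank-mono (suc k) p = least λ _ → below 0 (rank-mono k p)

scale-mono : ∀ {x y} → x ≤ y → scale x ≤ scale y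
-- The whole block of values `rank x k` fits under `scale y`. The strict bound on its `lsub` is what
-- `least` asks for in `scale-mono`.
scale-mono-< : ∀ {x y} → x < y → lsub (rank x) < scale y

scale-mono zero≤     = zero≤
scale-mono (least p) = least λ n → scale-mono-< (p n)

scale-mono-< (below n p) =
  below n (least λ k → below k (rank-mono k (scale-mono p)))

rank<scale : ∀ {x y} k → x < y → rank x k < scale y
rank<scale k x<y = <-≤-trans (f<lsub k) (<⇒≤ (scale-mono-< x<y))

rank-<ʳ : ∀ x {k l} → k ℕ.< l → rank x k < rank x l
rank-<ʳ x (ℕ.s≤s k≤l) with ℕ.m≤n⇒m<n∨m≡n k≤l
... | inj₁ k<l  = <-≤-trans (rank-<ʳ x k<l) (<⇒≤ (f<lsub 0))
... | inj₂ refl = f<lsub 0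

_⊕_ : ℕ → ℕ → ℕ
m ⊕ n = suc (m ℕ.+ n)

⊕-assoc : ∀ l m n → (l ⊕ m) ⊕ n ≡ l ⊕ (m ⊕ n)
⊕-assoc l m n = ≡.cong suc
  (≡.trans (≡.cong suc (ℕ.+-assoc l m n)) (≡.sym (ℕ.+-suc l (m ℕ.+ n))))

module _ (em : ExcludedMiddle 0ℓ) where

  -- Classical order theory of `Ord`.

  ¬¬-elim : {P : Set} → ¬ ¬ P → P
  ¬¬-elim = decidable-stable em

  minimum : {A : Set} {_⊏_ : Rel A 0ℓ} → WellFounded _⊏_ → (P : Pred A 0ℓ) →
            ∃ P → ∃[ x ] (P x × (∀ {y} → P y → ¬ y ⊏ x))
  minimum {_⊏_ = _⊏_} wf P (x , px) = descend px (wf x)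
    where
    descend : ∀ {x} → P x → Acc _⊏_ x → ∃[ x ] (P x × (∀ {y} → P y → ¬ y ⊏ x))
    descend {x} px (acc rs) with em {∃[ y ] (P y × y ⊏ x)}
    ... | yes (y , py , y⊏x) = descend py (rs y⊏x)
    ... | no  ∄y             = x , px , λ py y⊏x → ∄y (_ , py , y⊏x)

  ≤-<-connex : ∀ x y → x ≤ y ⊎ y < x
  ≤-<-connex zero     y = inj₁ zero≤
  ≤-<-connex (lsub f) y with em {∃[ n ] y ≤ f n}
  ... | yes (n , y≤) = inj₂ (below n y≤)
  ... | no  ∄n       = inj₁ (least λ n →
    Sum.[ (λ y≤ → contradiction (n , y≤) ∄n) , id ] (≤-<-connex y (f n)))

  ≮⇒≥ : ∀ {x y} → ¬ x < y → y ≤ x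
  ≮⇒≥ {x} {y} x≮y = Sum.[ id , (λ x<y → contradiction x<y x≮y) ] (≤-<-connex y x)

  ≤-totalOrder : TotalOrder 0ℓ 0ℓ 0ℓ
  ≤-totalOrder = record
    { _≈_ = _≃_
    ; _≤_ = _≤_
    ; isTotalOrder = record
      { isPartialOrder = record
        { isPreorder = record
          { isEquivalence = ≃.isEquivalence
          ; reflexive     = proj₁
          ; trans         = ≤-trans
          }
        ; antisym = _,_
        }
      ; total = λ x y → Sum.map₂ <⇒≤ (≤-<-connex x y)
      }
    }

  -- Words are countably many, so this makes every initial segment of `Ord` countable. Either `x` is
  -- the whole tree or it is at most some child, where the search continues.
  ≤⇒subtree : ∀ x y → x ≤ y → ∃[ w ] subtree y w ≃ x
  ≤⇒subtree x zero     x≤ = zero , zero≤ , x≤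
  ≤⇒subtree x (lsub f) x≤ with ≤-<-connex (lsub f) x
  ... | inj₁ ≤x             = zero , ≤x , x≤
  ... | inj₂ (below n x≤fn) with ≤⇒subtree x (f n) x≤fn
  ...   | w , eq = child n w , ≡.subst (_≃ x) (≡.sym (subtree-child f n w)) eq

  -- Cardinality of sets of ordinals.

  module _ {J : Setoid 0ℓ 0ℓ} (h : Injection J ≃-setoid) where
    open Injection h
    private
      module J = Setoid J

    -- An element is coded by a word leading from `β` to its image. The least code is taken, so that
    -- equal elements get equal codes.
    bounded⇒countable : ∀ β → (∀ j → to j ≤ β) → Countable J
    bounded⇒countable β bound = record
      { to        = proj₁ ∘ code
      ; cong      = λ {i} {j} i≈j → ℕ.≤-antisym (code-≤ i≈j) (code-≤ (J.sym i≈j))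
      ; injective = λ {i} {j} eq → injective
          (≃.trans (≃.sym (proj₁ (proj₂ (code i))))
            (≡.subst (λ n → subtree β (fromℕ n) ≃ to j) (≡.sym eq) (proj₁ (proj₂ (code j)))))
      }
      where
      Codes : J.Carrier → Pred ℕ 0ℓ
      Codes j n = subtree β (fromℕ n) ≃ to j

      code : ∀ j → ∃[ n ] (Codes j n × (∀ {m} → Codes j m → ¬ m ℕ.< n))
      code j with ≤⇒subtree (to j) β (bound j)
      ... | w , eq = minimum <-wellFounded (Codes j)
        (toℕ w , ≡.subst (λ w → subtree β w ≃ to j) (≡.sym (fromℕ-toℕ w)) eq)

      code-≤ : ∀ {i j} → i J.≈ j → proj₁ (code i) ℕ.≤ proj₁ (code j)
      code-≤ {i} {j} i≈j = ℕ.≮⇒≥ (proj₂ (proj₂ (code i))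
        (≃.trans (proj₁ (proj₂ (code j))) (cong (J.sym i≈j))))

    -- Transfinite recursion: lsub f goes to the least j whose image exceeds
    -- those of all f n.
    unbounded⇒Ord↣ : (∀ β → ∃[ j ] β ≤ to j) → Injection ≃-setoid J
    unbounded⇒Ord↣ unbounded = record
      { to        = pick
      ; cong      = λ (p , q) → injective (pick-mono p , pick-mono q)
      ; injective = λ eq → reflect (proj₁ (cong eq)) , reflect (proj₂ (cong eq))
      }
      where
      above : ∀ β → ∃[ j ] (β ≤ to j × (∀ {k} → β ≤ to k → ¬ to k < to j))
      above β = minimum (On.wellFounded to <-wf) (λ j → β ≤ to j) (unbounded β)

      pick : Ord → J.Carrier
      pick zero     = proj₁ (above zero)
      pick (lsub f) = proj₁ (above (lsub (to ∘ pick ∘ f)))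

      pick-mono : ∀ {x y} → x ≤ y → to (pick x) ≤ to (pick y)
      pick-mono-< : ∀ {x y} → x < y → to (pick x) < to (pick y)

      -- The image of the larger ordinal's pick meets the bound for which the smaller ordinal's pick
      -- is least.
      pick-mono zero≤             = ≮⇒≥ (proj₂ (proj₂ (above zero)) zero≤)
      pick-mono (least {f = f} p) =
        ≮⇒≥ (proj₂ (proj₂ (above (lsub (to ∘ pick ∘ f)))) (least λ n → pick-mono-< (p n)))

      pick-mono-< (below {f = f} n p) = ≤-<-trans (pick-mono p)
        (<-≤-trans (f<lsub n) (proj₁ (proj₂ (above (lsub (to ∘ pick ∘ f))))))

      reflect : ∀ {x y} → to (pick x) ≤ to (pick y) → x ≤ y
      reflect p = ≮⇒≥ λ y<x → <-irrefl (<-≤-trans (pick-mono-< y<x) p)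

    -- A set of ordinals is bounded, hence countable, or unbounded, hence contains a copy of `Ord`.
    -- Thus size below ω₁ means countable.
    ¬Ord↣⇒countable : ¬ Injection ≃-setoid J → Countable J
    ¬Ord↣⇒countable ∄inj with em {∃[ β ] ∀ j → to j ≤ β}
    ... | yes (β , bound) = bounded⇒countable β bound
    ... | no  ∄bound      = contradiction
      (unbounded⇒Ord↣ λ β → ¬¬-elim λ ∄j → ∄bound
        (β , λ j → ≮⇒≥ λ β< → ∄j (j , <⇒≤ β<)))
      ∄inj

  -- F need not respect the equality of J, hence j is only bounded up to it.
  countable⇒bounded : ∀ {J} → Countable J → (F : Setoid.Carrier J → Ord) →
                      ∃[ β ] ∀ j → ∃[ i ] (Setoid._≈_ J i j × F i < β)
  countable⇒bounded {J} c F = lsub (value ∘ preimage) , λ j → bound j (f<lsub (to j))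
    where
    open Injection c
    module J = Setoid J

    Preimage : ℕ → Set
    Preimage n = ∃[ j ] to j ≡ n

    preimage : ∀ n → Dec (Preimage n)
    preimage n = em

    value : ∀ {n} → Dec (Preimage n) → Ord
    value (yes (j , _)) = F j
    -- A harmless default: `bound` looks only at numbers in the image of `J`.
    value (no _)        = zero

    bound : ∀ j {β} → value (preimage (to j)) < β → ∃[ i ] (i J.≈ j × F i < β)
    bound j lt with preimage (to j)
    ... | yes (i , eq) = i , injective eq , lt
    ... | no  ∄i       = contradiction (j , refl) ∄i

  -- A strict bound for the identity would exceed every ordinal, itself included.
  Ord-uncountable : Uncountable ≃-setoid
  Ord-uncountable c with countable⇒bounded c id
  ... | β , bound with bound β
  ...   | x , (x≤β , β≤x) , x<β = <-irrefl (<-≤-trans x<β β≤x)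

  -- The semigroup.

  open Max ≤-totalOrder
    using (⊔-magma; ⊔-assoc; ⊔-comm; ⊔-sel; ⊔-idem; x≤x⊔y; x≤y⊔x; x≤y⇒x⊔y≈y; x⊔y≈x⇒y≤x)

  module Lex = LexProduct ⊔-magma (≡.magma _⊕_) (λ _ _ → em)

  S : Semigroup 0ℓ 0ℓ
  S = record
    { _∙_ = Lex._⊕_
    ; isSemigroup = record
      { isMagma = record
        { isEquivalence = Setoid.isEquivalence (×-setoid ≃-setoid (≡.setoid ℕ))
        ; ∙-cong        = Lex.cong
        }
      ; assoc = Lex.assoc ⊔-assoc ⊔-comm ⊔-sel ⊕-assoc
      }
    }

  open Semigroup S using (Carrier; _∙_; ∙-cong; setoid)
    renaming (_≈_ to _≋_; refl to ≋-refl; sym to ≋-sym; trans to ≋-trans)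

  absorbˡ : ∀ {a b} → proj₁ a < proj₁ b → a ∙ b ≋ b
  absorbˡ {a , m} {b , n} a<b = Lex.case₂
    (λ eq → <-irrefl (<-≤-trans a<b (x⊔y≈x⇒y≤x {a} {b} eq)))
    (x≤y⇒x⊔y≈y (<⇒≤ a<b)) m n

  no-idempotent : ¬ (∃[ e ] _IdempotentOn_ _≋_ _∙_ e)
  no-idempotent ((a , n) , idem) = ℕ.m≢1+m+n n (≡.sym
    (≡.trans (≡.sym (proj₂ (Lex.case₃ (⊔-idem a) (⊔-idem a) n n))) (proj₂ idem)))

  -- Carries the counting of sets of ordinals over to subsets of `S`.
  S↣Ord : Injection setoid ≃-setoid
  S↣Ord = record
    { to        = λ (x , k) → rank x k
    ; cong      = λ { {x , k} ((p , q) , refl) →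
                      rank-mono k (scale-mono p) , rank-mono k (scale-mono q) }
    ; injective = λ { {x , k} {y , l} (p , q) → inj x y k l p q }
    }
    where
    proj₁-≤ : ∀ x y k l → rank x k ≤ rank y l → x ≤ y
    proj₁-≤ x y k l p = ≮⇒≥ λ y<x → <-irrefl
      (<-≤-trans (rank<scale l y<x) (≤-trans (scale≤rank x k) p))

    proj₂-≤ : ∀ x y k l → x ≤ y → rank y l ≤ rank x k → l ℕ.≤ k
    proj₂-≤ x y k l x≤y p = ℕ.≮⇒≥ λ k<l → <-irrefl
      (<-≤-trans (rank-<ʳ y k<l) (≤-trans p (rank-mono k (scale-mono x≤y))))

    inj : ∀ x y k l → rank x k ≤ rank y l → rank y l ≤ rank x k → (x , k) ≋ (y , l)
    inj x y k l p q = (x≤y , y≤x) , ℕ.≤-antisym (proj₂-≤ y x l k y≤x p) (proj₂-≤ x y k l x≤y q)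
      where
      x≤y = proj₁-≤ x y k l p
      y≤x = proj₁-≤ y x l k q

  Ord↣S : Injection ≃-setoid setoid
  Ord↣S = record
    { to        = _, 0
    ; cong      = _, refl
    ; injective = proj₁
    }

  S-uncountable : Uncountable setoid
  S-uncountable = Ord-uncountable ∘ Composition.injection Ord↣S

  subset↣ : (A : Pred Carrier 0ℓ) → Injection (subset setoid A) setoid
  subset↣ A = record { to = proj₁ ; cong = id ; injective = id }

  bounded-subset-countable : (A : Pred Carrier 0ℓ) → ∀ β → (∀ x → A x → proj₁ x < β) →
                             Countable (subset setoid A)
  bounded-subset-countable A β bound =
    bounded⇒countable (Composition.injection (subset↣ A) S↣Ord) (scale β)
      λ ((x , k) , x∈A) → <⇒≤ (rank<scale k (bound (x , k) x∈A))

  -- Very weak cancellativity.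

  smallUnions : (Q : Pred Carrier 0ℓ → Set) →
                (∀ {P} → Q P → ∃[ β ] ∀ x → P x → proj₁ x ≤ β) → SmallUnions S Q
  smallUnions Q Q-bounded I (I↣S , ¬S↣I) L all-Q =
    subset↣ U , λ S↣U → S-uncountable (Composition.injection S↣U U-countable)
    where
    U : Pred Carrier 0ℓ
    U x = ∃[ i ] Func.to L i x

    I-countable : Countable I
    -- A copy of `Ord` in `I` would contain a copy of `S`.
    I-countable = ¬Ord↣⇒countable (Composition.injection I↣S S↣Ord)
      (¬S↣I ∘ Composition.injection S↣Ord)

    U-countable : Countable (subset setoid U)
    U-countable with countable⇒bounded I-countable (proj₁ ∘ Q-bounded ∘ all-Q)
    ... | β , bound = bounded-subset-countable U β λ x (i , x∈Li) →
      -- The bound is known only for some index `j` equal to `i`, but `L` sends both to the same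
      -- subset.
      let j , j≈i , <β = bound i
      in ≤-<-trans (proj₂ (Q-bounded (all-Q j)) x (proj₂ (Func.cong L j≈i) x∈Li)) <β

  veryWeaklyCancellative : VeryWeaklyCancellative S
  veryWeaklyCancellative =
    smallUnions (IsLeftSolutionSet S) (λ (a , b , P⊆ , _) → proj₁ b , λ x x∈P →
      ≤-trans (x≤y⊔x (proj₁ a) (proj₁ x)) (proj₁ (proj₁ (P⊆ x∈P)))) ,
    smallUnions (IsRightSolutionSet S) (λ (a , b , P⊆ , _) → proj₁ b , λ x x∈P →
      ≤-trans (x≤x⊔y (proj₁ x) (proj₁ a)) (proj₁ (proj₁ (P⊆ x∈P))))

  -- IP sets.

  module _ (x : ℕ → Carrier) (x-< : ∀ n → proj₁ (x n) < proj₁ (x (suc n))) where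

    increasing : ∀ {m n} → m ℕ.< n → proj₁ (x m) < proj₁ (x n)
    increasing (ℕ.s≤s {n = n} m≤n) with ℕ.m≤n⇒m<n∨m≡n m≤n
    ... | inj₁ m<n  = ≤-<-trans (<⇒≤ (increasing m<n)) (x-< n)
    ... | inj₂ refl = x-< n

    -- Summed from the right, the tail is already its last term, which absorbs `x h`. The inequality
    -- `h ≤ k` keeps that term beyond every earlier index.
    sum≋last : ∀ h hs → Linked ℕ._<_ (h ∷ hs) →
               ∃[ k ] (h ℕ.≤ k × foldr₁ _∙_ (map x (h ∷ hs)) ≋ x k)
    sum≋last h []        _          = h , ℕ.≤-refl , ≋-refl
    sum≋last h (h′ ∷ hs) (h<h′ ∷ l) with sum≋last h′ hs l
    ... | k , h′≤k , eq = k , ℕ.<⇒≤ h<k ,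
      ≋-trans (∙-cong (≋-refl {x h}) eq) (absorbˡ (increasing h<k))
      where h<k = ℕ.<-≤-trans h<h′ h′≤k

  uncountable⇒IP : (A : Pred Carrier 0ℓ) → A Respects _≋_ →
                   Uncountable (subset setoid A) → IsIP S A
  uncountable⇒IP A resp uncountable = proj₁ ∘ x , λ where
      (h ∷ hs) linked → let k , _ , eq = sum≋last (proj₁ ∘ x) x-< h hs linked
                        in resp (≋-sym eq) (proj₂ (x k))
    where
    next : ∀ β → Σ[ a ∈ ∃ A ] β < proj₁ (proj₁ a)
    -- Otherwise `A` is bounded by `β`, hence countable. The successor `lsub (const β)` turns this
    -- into the strict bound required.
    next β = ¬¬-elim λ ∄a → uncountable (bounded-subset-countable A (lsub (const β))
      λ y y∈A → below 0 (≮⇒≥ λ β<y → ∄a ((y , y∈A) , β<y)))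

    x : ℕ → ∃ A
    x zero    = proj₁ (next zero)
    x (suc n) = proj₁ (next (proj₁ (proj₁ (x n))))

    x-< : ∀ n → proj₁ (proj₁ (x n)) < proj₁ (proj₁ (x (suc n)))
    x-< n = proj₂ (next (proj₁ (proj₁ (x n))))

theorem2p7 : ExcludedMiddle 0ℓ →
    Σ[ S ∈ Semigroup 0ℓ 0ℓ ] (let open Semigroup S in
    Uncountable setoid
    × VeryWeaklyCancellative S
    × ¬ (∃[ e ] _IdempotentOn_ _≈_ _∙_ e)
    × ((A : Pred Carrier 0ℓ) → A Respects _≈_ → Uncountable (subset setoid A) → IsIP S A))
theorem2p7 em =
  S em , S-uncountable em , veryWeaklyCancellative em , no-idempotent em , uncountable⇒IP em
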